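{- Let $S\subseteq\mathbb{N}$ be a numerical semigroup with multiplicity $m$ and conductor $c$, and suppose $q(S)=\lceil c/m\rceil=3$ (equivalently $2m<c\le 3m$). Then $S$ satisfies Wilf's conjecture, i.e. $e(S)\,|L(S)|\ge c(S)$.
   Context: $\mathbb{N}=\{0,1,2,\dots\}$. A numerical semigroup is a subset $S\subseteq\mathbb{N}$ closed under addition, containing $0$, with finite complement in $\mathbb{N}$. Its multiplicity is $m=\min(S\setminus\{0\})$; its conductor is $c=c(S)=\max(\mathbb{N}\setminus S)+1$; $L(S)=\{s\in S : s<c\}$; its embedding dimension $e(S)$ is the least number of elements generating $S$ as a semigroup (additive monoid). -}

module Defs where

open import Data.List using (List; length)
open import Data.List.Membership.Propositional using () renaming (_∈_ to _∈ₗ_)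
open import Data.List.Relation.Unary.Unique.Propositional using (Unique)
open import Data.Nat using (ℕ; suc; _+_; _≤_; _<_)
open import Data.Product using (_×_; ∃; ∃-syntax)
open import Data.Sum using (_⊎_)
open import Function.Bundles using (_⇔_)
open import Level using (Level)
open import Relation.Binary.PropositionalEquality using (_≡_; _≢_)
open import Relation.Unary using (Pred; _∈_; ∁; Empty; _≐_)

private
  variable
    ℓ : Level

IsMin : Pred ℕ ℓ → ℕ → Set ℓ
IsMin P m = m ∈ P × (∀ n → n ∈ P → m ≤ n)

IsMax : Pred ℕ ℓ → ℕ → Set ℓ
IsMax P m = m ∈ P × (∀ n → n ∈ P → n ≤ m)

-- A set has k elements when it is enumerated by a list of length k
-- without repetitions.
HasCardinality : Pred ℕ ℓ → ℕ → Set ℓ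
HasCardinality P k =
  ∃[ xs ] Unique xs × (∀ n → n ∈ P ⇔ n ∈ₗ xs) × length xs ≡ k

Finite : Pred ℕ ℓ → Set ℓ
Finite P = ∃ (HasCardinality P)

record IsNumericalSemigroup (S : Pred ℕ ℓ) : Set ℓ where
  field
    +-closed          : ∀ {a b} → a ∈ S → b ∈ S → a + b ∈ S
    0∈S               : 0 ∈ S
    finite-complement : Finite (∁ S)

IsMultiplicity : Pred ℕ ℓ → ℕ → Set ℓ
IsMultiplicity S = IsMin (λ s → s ∈ S × s ≢ 0)

-- c = max (ℕ ∖ S) + 1, with the usual convention max ∅ = -1, so that the
-- conductor of ℕ itself is 0.
IsConductor : Pred ℕ ℓ → ℕ → Set ℓ
IsConductor S c =
  (Empty (∁ S) × c ≡ 0) ⊎ (∃[ f ] IsMax (∁ S) f × c ≡ suc f)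

-- L(S), where c is the conductor of S.
L : Pred ℕ ℓ → ℕ → Pred ℕ ℓ
L S c s = s ∈ S × s < c

-- The additive submonoid of ℕ generated by the elements of a list.
data ⟨_⟩ (A : List ℕ) : ℕ → Set where
  gen  : ∀ {a} → a ∈ₗ A → a ∈ ⟨ A ⟩
  zero : 0 ∈ ⟨ A ⟩
  plus : ∀ {a b} → a ∈ ⟨ A ⟩ → b ∈ ⟨ A ⟩ → a + b ∈ ⟨ A ⟩

HasGeneratingSetOfSize : Pred ℕ ℓ → ℕ → Set ℓ
HasGeneratingSetOfSize S k = ∃[ A ] Unique A × length A ≡ k × ⟨ A ⟩ ≐ S

IsEmbeddingDimension : Pred ℕ ℓ → ℕ → Set ℓ
IsEmbeddingDimension S = IsMin (HasGeneratingSetOfSize S)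

{-# OPTIONS --safe #-}
module Submission where

-- Write c = m + d.  The nonzero Apéry elements with respect to m split by size
-- into levels X₁ = (0, d), X₂ = [d, m + d), X₃ = [m + d, 2m + d), and X₂, X₃
-- into primitive parts P₂, P₃ and decomposable parts D₂, D₃.  The numbers
-- e, |L| and m are then controlled by the sizes n, p, q, p₃, d₃ of X₁, P₂, D₂,
-- P₃, D₃, and it remains to bound d₃.  An element of D₃ is a sum of two
-- elements from X₁ ∪ P₂ ∪ D₂, of one of four kinds: X₁ + X₁ (t elements, where
-- 2 (q + t) ≤ n (n + 1)), X₁ + P₂ (at most n p), P₂ + P₂ (at most ρ = 3m - c,
-- and at most p (p + 1) / 2), and X₁ + D₂.  Elements of the last kind are sums
-- of three elements of X₁ all of whose partial pair sums lie in D₂, so double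
-- counting bounds their number h by 3 h ≤ q (n + 2); this elementary estimate
-- takes the place of Macaulay's theorem.

open import Defs
open import Data.Bool using (Bool; true; false)
import Data.Integer as ℤ
import Data.Integer.DivMod as ℤ
import Data.Integer.Properties as ℤ
import Data.Integer.Tactic.RingSolver as ℤ-Solver
open import Data.List using (List; []; _∷_; _++_; [_]; length; map; filter; upTo; cartesianProduct; cartesianProductWith)
open import Data.List.Membership.Propositional using () renaming (_∈_ to _∈ₗ_; _∉_ to _∉ₗ_)
open import Data.List.Membership.Propositional.Properties
open import Data.List.Properties using (length-++; length-map; length-++-sucʳ; length-upTo)
open import Data.List.Relation.Binary.Subset.Propositional using (_⊆_)
open import Data.List.Relation.Unary.All as All using (All; []; _∷_)
import Data.List.Relation.Unary.All.Properties as All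
open import Data.List.Relation.Unary.AllPairs using ([]; _∷_)
open import Data.List.Relation.Unary.Any using (here; there)
open import Data.List.Relation.Unary.Unique.Propositional using (Unique)
import Data.List.Relation.Unary.Unique.Propositional.Properties as Unique
open import Data.Maybe using (Maybe; just; nothing)
open import Data.Nat using (ℕ; zero; suc; NonZero; _+_; _*_; _∸_; _≤_; _<_; _≥_; z≤n; s≤s; _≟_; _≤?_; _<?_; _%_; >-nonZero)
open import Data.List.Membership.DecPropositional _≟_ using (_∈?_)
open import Data.Nat.DivMod using ([m+kn]%n≡m%n; m<n⇒m%n≡m; [m+n]%n≡m%n)
open import Data.Nat.Induction using (<-rec)
open import Data.Nat.Properties hiding (_≟_; _≤?_; _<?_)
open import Data.Nat.Tactic.RingSolver using (solve-∀)
open import Data.Product using (_×_; _,_; ∃-syntax; ∃₂; proj₁; proj₂)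
open import Data.Rational.Unnormalised using (_/_; ceiling)
open import Data.Sum using (_⊎_; inj₁; inj₂)
open import Function using (_∘_)
open import Function.Bundles using (Equivalence)
open import Level using (Level)
open import Relation.Binary.PropositionalEquality using (_≡_; _≢_; refl; sym; trans; cong; cong₂; subst; module ≡-Reasoning)
open import Relation.Nullary using (¬_; yes; no; ¬?; contradiction)
open import Relation.Nullary.Decidable using (_×-dec_; decidable-stable)
open import Relation.Binary.Definitions using (tri<; tri≈; tri>)
open import Relation.Unary using (Pred; Decidable; _∈_; _∉_; _∩_; ∁)
open import Relation.Unary.Properties using (_∩?_)

private
  variable
    A B : Set

-- Counting with lists

-- Pigeonhole by induction: the head is cut out of `ys`, and the tail, which avoids the head, still
-- lies in what remains.
unique-⊆⇒length-≤ : {xs ys : List A} → Unique xs → xs ⊆ ys → length xs ≤ length ys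
unique-⊆⇒length-≤ {xs = []} _ _ = z≤n
unique-⊆⇒length-≤ {xs = x ∷ xs} (x≢xs ∷ xs!) xs⊆ys with ∈-∃++ (xs⊆ys (here refl))
... | us , vs , refl = begin
  suc (length xs)           ≤⟨ s≤s (unique-⊆⇒length-≤ xs! xs⊆us++vs) ⟩
  suc (length (us ++ vs))   ≡⟨ length-++-sucʳ us x vs ⟨
  length (us ++ x ∷ vs)     ∎
  where
  open ≤-Reasoning
  xs⊆us++vs : xs ⊆ us ++ vs
  xs⊆us++vs y∈xs with ∈-++⁻ us (xs⊆ys (there y∈xs))
  ... | inj₁ y∈us         = ∈-++⁺ˡ y∈us
  ... | inj₂ (here refl)  = contradiction refl (All.lookup x≢xs y∈xs)
  ... | inj₂ (there y∈vs) = ∈-++⁺ʳ us y∈vs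

length-cartesianProductWith : {C : Set} (f : A → B → C) (xs : List A) (ys : List B) →
  length (cartesianProductWith f xs ys) ≡ length xs * length ys
length-cartesianProductWith f []       ys = refl
length-cartesianProductWith f (x ∷ xs) ys =
  trans (length-++ (map (f x) ys))
    (cong₂ _+_ (length-map (f x) ys) (length-cartesianProductWith f xs ys))

-- Double counting: fibres of `val` over distinct values are disjoint, so concatenating `r` tokens
-- for each entry of `zs` gives a repetition-free list inside `ts`.
multiplicity-count : (val : B → A) (r : ℕ) (ts : List B) (zs : List A) → Unique zs →
  (∀ {z} → z ∈ₗ zs →
    ∃[ bs ] Unique bs × length bs ≡ r × All (λ b → b ∈ₗ ts × val b ≡ z) bs) →
  length zs * r ≤ length ts
multiplicity-count {B = B} {A = A} val r ts zs zs! fibre =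
  let bs , bs! , len , bs∈ = collect zs zs! fibre in
  subst (_≤ length ts) len (unique-⊆⇒length-≤ bs! (proj₁ ∘ All.lookup bs∈))
  where
  Fibre : A → List B → Set
  Fibre z = All (λ b → b ∈ₗ ts × val b ≡ z)

  collect : (zs : List A) → Unique zs →
    (∀ {z} → z ∈ₗ zs → ∃[ bs ] Unique bs × length bs ≡ r × Fibre z bs) →
    ∃[ bs ] Unique bs × length bs ≡ length zs * r × All (λ b → b ∈ₗ ts × val b ∈ₗ zs) bs
  collect []       _            _     = [] , [] , refl , []
  collect (z ∷ zs) (z≢zs ∷ zs!) fibre
    with fibre (here refl) | collect zs zs! (fibre ∘ there)
  ... | bs , bs! , len , bs∈ | cs , cs! , len′ , cs∈ =
    bs ++ cs , Unique.++⁺ bs! cs! disjoint ,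
    trans (length-++ bs) (cong₂ _+_ len len′) ,
    All.++⁺ (All.map (λ (b∈ , eq) → b∈ , here eq) bs∈)
            (All.map (λ (b∈ , v∈) → b∈ , there v∈) cs∈)
    where
    disjoint : ∀ {b} → ¬ (b ∈ₗ bs × b ∈ₗ cs)
    disjoint (b∈bs , b∈cs) with All.lookup bs∈ b∈bs | All.lookup cs∈ b∈cs
    ... | _ , refl | _ , v∈zs = All.lookup z≢zs v∈zs refl

-- Sumsets and the double counting of sums

infixl 6 _⊕_
_⊕_ : List ℕ → List ℕ → List ℕ
_⊕_ = cartesianProductWith _+_

∈-⊕⁻ : ∀ xs ys {z} → z ∈ₗ xs ⊕ ys → ∃₂ λ x y → x ∈ₗ xs × y ∈ₗ ys × z ≡ x + y
∈-⊕⁻ = ∈-cartesianProductWith⁻ _+_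

∈-⊕⁺ : ∀ {xs ys x y} → x ∈ₗ xs → y ∈ₗ ys → x + y ∈ₗ xs ⊕ ys
∈-⊕⁺ = ∈-cartesianProductWith⁺ _+_

-- A sum x + y with x ≢ y is hit by (x, y) and (y, x); a double x + x
-- is hit by (x, x) and by the extra token (x, nothing).
⊕-square-count : ∀ X zs → Unique zs → zs ⊆ X ⊕ X →
  length zs * 2 ≤ length X * suc (length X)
⊕-square-count X zs zs! zs⊆ = begin
  length zs * 2                            ≤⟨ multiplicity-count val 2 tokens zs zs! fibre ⟩
  length tokens                            ≡⟨ length-cartesianProductWith _,_ X slots ⟩
  length X * suc (length (map just X))     ≡⟨ cong (λ l → length X * suc l) (length-map just X) ⟩
  length X * suc (length X)                ∎
  where
  open ≤-Reasoning
  slots : List (Maybe ℕ)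
  slots = nothing ∷ map just X
  tokens : List (ℕ × Maybe ℕ)
  tokens = cartesianProduct X slots
  val : ℕ × Maybe ℕ → ℕ
  val (x , just y)  = x + y
  val (x , nothing) = x + x
  pair∈ : ∀ {x y} → x ∈ₗ X → y ∈ₗ X → (x , just y) ∈ₗ tokens
  pair∈ x∈ y∈ = ∈-cartesianProduct⁺ x∈ (there (∈-map⁺ just y∈))
  fibre : ∀ {z} → z ∈ₗ zs →
    ∃[ bs ] Unique bs × length bs ≡ 2 × All (λ b → b ∈ₗ tokens × val b ≡ z) bs
  fibre z∈ with ∈-⊕⁻ X X (zs⊆ z∈)
  ... | x , y , x∈ , y∈ , refl with x ≟ y
  ...   | yes refl = (x , just x) ∷ (x , nothing) ∷ [] ,
    ((λ ()) ∷ []) ∷ [] ∷ [] , refl ,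
    (pair∈ x∈ x∈ , refl) ∷ (∈-cartesianProduct⁺ x∈ (here refl) , refl) ∷ []
  ...   | no x≢y = (x , just y) ∷ (y , just x) ∷ [] ,
    ((x≢y ∘ cong proj₁) ∷ []) ∷ [] ∷ [] , refl ,
    (pair∈ x∈ y∈ , refl) ∷ (pair∈ y∈ x∈ , +-comm y x) ∷ []

-- Fix for every u in D a decomposition u = a + b with a, b in X.  An element
-- of H is hit at least three times by the sums u + x (u in D, x in X)
-- together with the two extra sums u + a and u + b for each u in D.
⊕-cube-count : ∀ X D H → Unique H → D ⊆ X ⊕ X → H ⊆ X ⊕ D →
  (∀ {x y w} → x ∈ₗ X → y ∈ₗ X → w ∈ₗ X → x + y + w ∈ₗ H → x + y ∈ₗ D) →
  length H * 3 ≤ length D * (2 + length X)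
⊕-cube-count X D H H! D⊆ H⊆ closed = begin
  length H * 3                                ≤⟨ multiplicity-count val 3 tokens H H! fibre ⟩
  length tokens                               ≡⟨ length-cartesianProductWith _,_ D slots ⟩
  length D * (2 + length (map inj₂ X))        ≡⟨ cong (λ l → length D * (2 + l)) (length-map inj₂ X) ⟩
  length D * (2 + length X)                   ∎
  where
  open ≤-Reasoning
  slots : List (Bool ⊎ ℕ)
  slots = inj₁ false ∷ inj₁ true ∷ map inj₂ X
  tokens : List (ℕ × (Bool ⊎ ℕ))
  tokens = cartesianProduct D slots

  -- The junk value 0 outside X ⊕ X is never used.
  left right : ℕ → ℕ
  left u with u ∈? X ⊕ X
  ... | yes u∈ = proj₁ (∈-⊕⁻ X X u∈)
  ... | no _   = 0
  right u with u ∈? X ⊕ X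
  ... | yes u∈ = proj₁ (proj₂ (∈-⊕⁻ X X u∈))
  ... | no _   = 0
  split : ∀ {u} → u ∈ₗ D → left u ∈ₗ X × right u ∈ₗ X × u ≡ left u + right u
  split {u} u∈D with u ∈? X ⊕ X
  ... | yes u∈ = proj₂ (proj₂ (∈-⊕⁻ X X u∈))
  ... | no u∉  = contradiction (D⊆ u∈D) u∉

  part : Bool → ℕ → ℕ
  part false = left
  part true  = right

  val : ℕ × (Bool ⊎ ℕ) → ℕ
  val (u , inj₁ i) = u + part i u
  val (u , inj₂ x) = u + x

  sum∈ : ∀ {u x} → u ∈ₗ D → x ∈ₗ X → (u , inj₂ x) ∈ₗ tokens
  sum∈ u∈ x∈ = ∈-cartesianProduct⁺ u∈ (there (there (∈-map⁺ inj₂ x∈)))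
  part∈ : ∀ i {u} → u ∈ₗ D → (u , inj₁ i) ∈ₗ tokens
  part∈ false u∈ = ∈-cartesianProduct⁺ u∈ (here refl)
  part∈ true  u∈ = ∈-cartesianProduct⁺ u∈ (there (here refl))

  Fibre : ℕ → Set
  Fibre z = ∃[ bs ] Unique bs × length bs ≡ 3 × All (λ b → b ∈ₗ tokens × val b ≡ z) bs

  slot≢ : ∀ {u v : ℕ} {s t : Bool ⊎ ℕ} → s ≢ t → (u , s) ≢ (v , t)
  slot≢ s≢t refl = s≢t refl
  inj₂≢ : {x y : ℕ} → x ≢ y → _≢_ {A = Bool ⊎ ℕ} (inj₂ x) (inj₂ y)
  inj₂≢ x≢y refl = x≢y refl

  swap₂₃ : ∀ x y w → x + y + w ≡ x + w + y
  swap₂₃ = solve-∀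
  rotate : ∀ x y w → x + y + w ≡ y + w + x
  rotate = solve-∀

  -- Any of the three distinct summands can be the one added last, which gives tokens with different
  -- second components.
  three-sums : ∀ {x y w} → x ∈ₗ X → y ∈ₗ X → w ∈ₗ X → x + y + w ∈ₗ H →
    x ≢ y → x ≢ w → y ≢ w → Fibre (x + y + w)
  three-sums {x} {y} {w} x∈ y∈ w∈ z∈ x≢y x≢w y≢w =
    (x + y , inj₂ w) ∷ (x + w , inj₂ y) ∷ (y + w , inj₂ x) ∷ [] ,
    (slot≢ (inj₂≢ (y≢w ∘ sym)) ∷ slot≢ (inj₂≢ (x≢w ∘ sym)) ∷ []) ∷
      (slot≢ (inj₂≢ (x≢y ∘ sym)) ∷ []) ∷ [] ∷ [] , refl ,
    (sum∈ (closed x∈ y∈ w∈ z∈) w∈ , refl) ∷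
    (sum∈ (closed x∈ w∈ y∈ (subst (_∈ₗ H) (swap₂₃ x y w) z∈)) y∈ , swap₂₃ x w y) ∷
    (sum∈ (closed y∈ w∈ x∈ (subst (_∈ₗ H) (rotate x y w) z∈)) x∈ , sym (rotate x y w)) ∷ []

  -- The third token is the extra one of `x + y` whose chosen summand is `x`; `i` records on which
  -- side `x` occurs.
  marker : ∀ i {x y} → x ∈ₗ X → y ∈ₗ X → x ≢ y → x + x + y ∈ₗ H →
    part i (x + y) ≡ x → Fibre (x + x + y)
  marker i {x} {y} x∈ y∈ x≢y z∈ eq =
    (x + x , inj₂ y) ∷ (x + y , inj₂ x) ∷ (x + y , inj₁ i) ∷ [] ,
    (slot≢ (inj₂≢ (x≢y ∘ sym)) ∷ slot≢ (λ ()) ∷ []) ∷ (slot≢ (λ ()) ∷ []) ∷ [] ∷ [] , refl ,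
    (sum∈ (closed x∈ x∈ y∈ z∈) y∈ , refl) ∷
    (sum∈ xy∈ x∈ , swap₂₃ x y x) ∷
    (part∈ i xy∈ , trans (cong (x + y +_) eq) (swap₂₃ x y x)) ∷ []
    where
    xy∈ : x + y ∈ₗ D
    xy∈ = closed x∈ y∈ x∈ (subst (_∈ₗ H) (swap₂₃ x x y) z∈)

  fibre-xxy : ∀ {x y} → x ∈ₗ X → y ∈ₗ X → x ≢ y → x + x + y ∈ₗ H → Fibre (x + x + y)
  fibre-xxy {x} {y} x∈ y∈ x≢y z∈
    with split (closed x∈ y∈ x∈ (subst (_∈ₗ H) (swap₂₃ x x y) z∈))
       | left (x + y) ≟ x | right (x + y) ≟ x
  ... | _ | yes l≡x | _       = marker false x∈ y∈ x≢y z∈ l≡x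
  ... | _ | no _    | yes r≡x = marker true x∈ y∈ x≢y z∈ r≡x
  ... | l∈ , r∈ , xy≡ | no l≢x | no r≢x with left (x + y) ≟ right (x + y)
  -- Both chosen summands of `x + y` avoid `x`. If they differ, the same total is a sum of three
  -- distinct elements.
  ...   | no l≢r = subst Fibre z≡
      (three-sums l∈ r∈ x∈ (subst (_∈ₗ H) (sym z≡) z∈) l≢r l≢x r≢x)
      where
      z≡ : left (x + y) + right (x + y) + x ≡ x + x + y
      z≡ = trans (cong (_+ x) (sym xy≡)) (swap₂₃ x y x)
  -- Here x + y = l + l with l ≢ x, so the tokens are {2x, y}, {x + y, x}, {x + l, l}.
  ...   | yes l≡r =
    (x + x , inj₂ y) ∷ (x + y , inj₂ x) ∷ (x + l , inj₂ l) ∷ [] ,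
    (slot≢ (inj₂≢ (x≢y ∘ sym)) ∷ slot≢ (inj₂≢ y≢l) ∷ []) ∷
      (slot≢ (inj₂≢ (l≢x ∘ sym)) ∷ []) ∷ [] ∷ [] , refl ,
    (sum∈ (closed x∈ x∈ y∈ z∈) y∈ , refl) ∷
    (sum∈ (closed x∈ y∈ x∈ (subst (_∈ₗ H) (swap₂₃ x x y) z∈)) x∈ , swap₂₃ x y x) ∷
    (sum∈ (closed x∈ l∈ l∈ (subst (_∈ₗ H) (sym z≡) z∈)) l∈ , z≡) ∷ []
    where
    l : ℕ
    l = left (x + y)
    xy≡ll : x + y ≡ l + l
    xy≡ll = trans xy≡ (cong (l +_) (sym l≡r))
    y≢l : y ≢ l
    y≢l y≡l = l≢x (sym (+-cancelʳ-≡ l x l (trans (cong (x +_) (sym y≡l)) xy≡ll)))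
    z≡ : x + l + l ≡ x + x + y
    z≡ = trans (+-assoc x l l) (trans (cong (x +_) (sym xy≡ll)) (sym (+-assoc x x y)))

  -- If the chosen decomposition of `x + x` is `x + x` itself, both extra tokens hit the total.
  -- Otherwise the chosen summands lie on opposite sides of `x`, and the total is a sum of three
  -- distinct elements.
  fibre-xxx : ∀ {x} → x ∈ₗ X → x + x + x ∈ₗ H → Fibre (x + x + x)
  fibre-xxx {x} x∈ z∈ with closed x∈ x∈ x∈ z∈
  ... | xx∈ with split xx∈ | left (x + x) ≟ x
  ...   | _ , _ , xx≡ | yes l≡x =
    (x + x , inj₂ x) ∷ (x + x , inj₁ false) ∷ (x + x , inj₁ true) ∷ [] ,
    (slot≢ (λ ()) ∷ slot≢ (λ ()) ∷ []) ∷ (slot≢ (λ ()) ∷ []) ∷ [] ∷ [] , refl ,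
    (sum∈ xx∈ x∈ , refl) ∷ (part∈ false xx∈ , cong (x + x +_) l≡x) ∷
    (part∈ true xx∈ , cong (x + x +_) r≡x) ∷ []
    where
    r≡x : right (x + x) ≡ x
    r≡x = sym (+-cancelˡ-≡ x x _ (trans xx≡ (cong (_+ right (x + x)) l≡x)))
  ...   | l∈ , r∈ , xx≡ | no l≢x = subst Fibre (cong (_+ x) (sym xx≡))
    (three-sums l∈ r∈ x∈ (subst (_∈ₗ H) (cong (_+ x) xx≡) z∈) l≢r l≢x r≢x)
    where
    r≢x : right (x + x) ≢ x
    r≢x r≡x = l≢x (sym (+-cancelʳ-≡ x x _ (trans xx≡ (cong (left (x + x) +_) r≡x))))
    l≢r : left (x + x) ≢ right (x + x)
    l≢r l≡r with <-cmp x (left (x + x))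
    ... | tri< x<l _ _ = <⇒≢ (+-mono-< x<l (subst (x <_) l≡r x<l)) xx≡
    ... | tri≈ _ x≡l _ = l≢x (sym x≡l)
    ... | tri> _ _ l<x = <⇒≢ (+-mono-< l<x (subst (_< x) l≡r l<x)) (sym xx≡)

  fibre-sum : ∀ {x y w} → x ∈ₗ X → y ∈ₗ X → w ∈ₗ X → x + y + w ∈ₗ H → Fibre (x + y + w)
  fibre-sum {x} {y} {w} x∈ y∈ w∈ z∈ with x ≟ y | x ≟ w | y ≟ w
  ... | yes refl | yes refl | _        = fibre-xxx x∈ z∈
  ... | yes refl | no x≢w   | _        = fibre-xxy x∈ w∈ x≢w z∈
  ... | no x≢y   | yes refl | _        = subst Fibre (swap₂₃ x x y)
    (fibre-xxy x∈ y∈ x≢y (subst (_∈ₗ H) (sym (swap₂₃ x x y)) z∈))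
  ... | no x≢y   | no x≢w   | yes refl = subst Fibre (sym (rotate x y y))
    (fibre-xxy y∈ x∈ (x≢y ∘ sym) (subst (_∈ₗ H) (rotate x y y) z∈))
  ... | no x≢y   | no x≢w   | no y≢w   = three-sums x∈ y∈ w∈ z∈ x≢y x≢w y≢w

  fibre : ∀ {z} → z ∈ₗ H → Fibre z
  fibre z∈ with ∈-⊕⁻ X D (H⊆ z∈)
  ... | x , u , x∈ , u∈ , refl with ∈-⊕⁻ X X (D⊆ u∈)
  ...   | y , w , y∈ , w∈ , refl = subst Fibre (+-assoc x y w)
    (fibre-sum x∈ y∈ w∈ (subst (_∈ₗ H) (sym (+-assoc x y w)) z∈))

-- Numerical semigroups of depth three

SumOfNonzero : {ℓ : Level} → Pred ℕ ℓ → Pred ℕ ℓ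
SumOfNonzero S z = ∃₂ λ a b → a ∈ S × b ∈ S × 0 < a × 0 < b × z ≡ a + b

sumOfNonzero? : {S : Pred ℕ Level.zero} → Decidable S → Decidable (SumOfNonzero S)
sumOfNonzero? {S} S? z with anyUpTo? (λ a → S? a ×-dec S? (z ∸ a) ×-dec 0 <? a) z
... | yes (a , a<z , Sa , Sz∸a , 0<a) =
  yes (a , z ∸ a , Sa , Sz∸a , 0<a , m<n⇒0<n∸m a<z , sym (m+[n∸m]≡n (<⇒≤ a<z)))
... | no ¬sum = no λ where
  (a , b , Sa , Sb , 0<a , 0<b , refl) →
    ¬sum (a , m<m+n a 0<b , Sa , subst S (sym (m+n∸m≡n a b)) Sb , 0<a)

<-summand : ∀ a {b c d} → a + b < c + d → d ≤ b → a < c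
<-summand a {b} {c} {d} a+b<c+d d≤b = +-cancelʳ-< d a c (≤-<-trans (+-monoʳ-≤ a d≤b) a+b<c+d)

-- The sizes are those of X₁, P₂, D₂, P₃, D₃ and of the four pieces of D₃ below.
wilf-arithmetic : ∀ n p q p₃ d₃ t s h r ρ →
  (q + t) * 2 ≤ n * suc n → s ≤ n * p → h * 3 ≤ q * (2 + n) →
  r * 2 ≤ p * suc p → r ≤ ρ → d₃ ≤ t + (s + (h + r)) →
  suc (n + (p + (q + (p₃ + d₃)))) * 3 ≤
    suc (n + (p + p₃)) * (suc (suc n) + suc (n + (p + q))) + ρ
wilf-arithmetic n p q p₃ d₃ t s h r ρ t≤ s≤ h≤ r≤ r≤ρ d₃≤ = begin
  suc (n + (p + (q + (p₃ + d₃)))) * 3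
    ≤⟨ *-monoˡ-≤ 3 (s≤s (+-monoʳ-≤ n (+-monoʳ-≤ p (+-monoʳ-≤ q (+-monoʳ-≤ p₃ d₃≤))))) ⟩
  suc (n + (p + (q + (p₃ + (t + (s + (h + r))))))) * 3
    -- The spare `t` raises its coefficient to 4. Together with the `q * 2` coming from the bound on
    -- `h`, the terms in `q` and `t` become `q + 4 (q + t)`, ready for twice the first hypothesis.
    ≤⟨ m≤m+n _ t ⟩
  suc (n + (p + (q + (p₃ + (t + (s + (h + r))))))) * 3 + t
    ≡⟨ regroup n p q p₃ t s h r ⟩
  (3 + 3 * n + 3 * p + 3 * p₃ + 3 * q + 4 * t) + (s * 3 + (h * 3 + (r * 2 + r)))
    -- Of the three copies of `r`, two are bounded through `p * suc p` and the third by `ρ`.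
    ≤⟨ +-monoʳ-≤ (3 + 3 * n + 3 * p + 3 * p₃ + 3 * q + 4 * t)
         (+-mono-≤ (*-monoˡ-≤ 3 s≤) (+-mono-≤ h≤ (+-mono-≤ r≤ r≤ρ))) ⟩
  (3 + 3 * n + 3 * p + 3 * p₃ + 3 * q + 4 * t) + (n * p * 3 + (q * (2 + n) + (p * suc p + ρ)))
    ≡⟨ regroup′ n p q p₃ t ρ ⟩
  (3 + 3 * n + 3 * p + 3 * p₃ + q + n * p * 3 + q * n + p * suc p + ρ) + (q + t) * 2 * 2
    ≤⟨ +-monoʳ-≤ (3 + 3 * n + 3 * p + 3 * p₃ + q + n * p * 3 + q * n + p * suc p + ρ)
         (*-monoˡ-≤ 2 t≤) ⟩
  (3 + 3 * n + 3 * p + 3 * p₃ + q + n * p * 3 + q * n + p * suc p + ρ) + n * suc n * 2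
    -- The added terms are exactly the slack left in the final product.
    ≤⟨ m≤m+n _ (p * q + p₃ * (2 * n + p + q)) ⟩
  (3 + 3 * n + 3 * p + 3 * p₃ + q + n * p * 3 + q * n + p * suc p + ρ) + n * suc n * 2
    + (p * q + p₃ * (2 * n + p + q))
    ≡⟨ expand n p q p₃ ρ ⟩
  suc (n + (p + p₃)) * (suc (suc n) + suc (n + (p + q))) + ρ ∎
  where
  open ≤-Reasoning
  regroup : ∀ n p q p₃ t s h r →
    suc (n + (p + (q + (p₃ + (t + (s + (h + r))))))) * 3 + t ≡
    (3 + 3 * n + 3 * p + 3 * p₃ + 3 * q + 4 * t) + (s * 3 + (h * 3 + (r * 2 + r)))
  regroup = solve-∀
  regroup′ : ∀ n p q p₃ t ρ →
    (3 + 3 * n + 3 * p + 3 * p₃ + 3 * q + 4 * t) + (n * p * 3 + (q * (2 + n) + (p * suc p + ρ))) ≡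
    (3 + 3 * n + 3 * p + 3 * p₃ + q + n * p * 3 + q * n + p * suc p + ρ) + (q + t) * 2 * 2
  regroup′ = solve-∀
  expand : ∀ n p q p₃ ρ →
    (3 + 3 * n + 3 * p + 3 * p₃ + q + n * p * 3 + q * n + p * suc p + ρ) + n * suc n * 2
      + (p * q + p₃ * (2 * n + p + q)) ≡
    suc (n + (p + p₃)) * (suc (suc n) + suc (n + (p + q))) + ρ
  expand = solve-∀

-- The conductor is m + d and has depth three: 2 m < m + d = 3 m ∸ ρ.
module DepthThree
  (S : Pred ℕ Level.zero) (S? : Decidable S)
  (0∈S : 0 ∈ S) (+-closed : ∀ {a b} → a ∈ S → b ∈ S → a + b ∈ S)
  (m d ρ : ℕ) (0<m : 0 < m) (m∈S : m ∈ S)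
  (m-least : ∀ {x} → x ∈ S → 0 < x → m ≤ x)
  (m<d : m < d) (d+ρ≡2m : d + ρ ≡ m + m)
  (conductor : ∀ {x} → m + d ≤ x → x ∈ S)
  where

  d≤2m : d ≤ m + m
  d≤2m = subst (d ≤_) d+ρ≡2m (m≤m+n d ρ)

  -- Apéry elements with respect to `m`

  Apéry : Pred ℕ Level.zero
  Apéry x = x ∈ S × ¬ (m ≤ x × x ∸ m ∈ S)

  Apéry? : Decidable Apéry
  Apéry? x = S? x ×-dec ¬? (m ≤? x ×-dec S? (x ∸ m))

  Decomposable : Pred ℕ Level.zero
  Decomposable = SumOfNonzero S

  Decomposable? : Decidable Decomposable
  Decomposable? = sumOfNonzero? S?

  m+S∉Apéry : ∀ {x} → x ∈ S → m + x ∉ Apéry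
  m+S∉Apéry {x} x∈S (_ , ¬shift) = ¬shift (m≤m+n m x , subst S (sym (m+n∸m≡n m x)) x∈S)

  0∈Apéry : 0 ∈ Apéry
  0∈Apéry = 0∈S , λ (m≤0 , _) → <⇒≱ 0<m m≤0

  -- If `m` could be subtracted from the summand inside `S`, it could be subtracted from the sum as
  -- well.
  Apéry-summandʳ : ∀ {a b} → a ∈ S → b ∈ S → a + b ∈ Apéry → b ∈ Apéry
  Apéry-summandʳ {a} {b} a∈S b∈S (_ , ¬shift) = b∈S , λ (m≤b , b∸m∈S) →
    ¬shift (≤-trans m≤b (m≤n+m b a) ,
      subst S (sym (+-∸-assoc a m≤b)) (+-closed a∈S b∸m∈S))

  Apéry-summandˡ : ∀ {a b} → a ∈ S → b ∈ S → a + b ∈ Apéry → a ∈ Apéry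
  Apéry-summandˡ {a} {b} a∈S b∈S = Apéry-summandʳ b∈S a∈S ∘ subst Apéry (+-comm a b)

  Apéry-> : ∀ {x} → x ∈ Apéry → 0 < x → m < x
  Apéry-> {x} x∈Ap 0<x = ≤∧≢⇒< (m-least (proj₁ x∈Ap) 0<x) λ where
    refl → m+S∉Apéry 0∈S (subst Apéry (sym (+-identityʳ m)) x∈Ap)

  -- From `m + (m + d)` on, `x ∸ m` still reaches the conductor and so lies in `S`.
  Apéry-< : ∀ {x} → x ∈ Apéry → x < m + (m + d)
  Apéry-< {x} (_ , ¬shift) = ≰⇒> λ bound → ¬shift
    (≤-trans (m≤m+n m (m + d)) bound ,
     conductor (subst (_≤ x ∸ m) (m+n∸m≡n m (m + d)) (∸-monoˡ-≤ m bound)))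

  decomposable-≥2m : ∀ {x} → x ∈ Decomposable → m + m ≤ x
  decomposable-≥2m (a , b , a∈S , b∈S , 0<a , 0<b , refl) =
    +-mono-≤ (m-least a∈S 0<a) (m-least b∈S 0<b)

  -- Levels and their primitive and decomposable parts

  Level₁ Level₂ Level₃ : Pred ℕ Level.zero
  Level₁ x = x ∈ Apéry × 0 < x × x < d
  Level₂ x = x ∈ Apéry × d ≤ x × x < m + d
  Level₃ x = x ∈ Apéry × m + d ≤ x

  Level₁? : Decidable Level₁
  Level₁? x = Apéry? x ×-dec 0 <? x ×-dec x <? d
  Level₂? : Decidable Level₂
  Level₂? x = Apéry? x ×-dec d ≤? x ×-dec x <? m + d
  Level₃? : Decidable Level₃
  Level₃? x = Apéry? x ×-dec m + d ≤? x

  Indecomposable? : Decidable (_∉ Decomposable)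
  Indecomposable? x = ¬? (Decomposable? x)

  -- By `Apéry-<` this range contains every Apéry element; it also caps the third level from above.
  enumerate : {P : Pred ℕ Level.zero} → Decidable P → List ℕ
  enumerate P? = filter P? (upTo (m + (m + d)))

  enumerate! : ∀ {P : Pred ℕ Level.zero} (P? : Decidable P) → Unique (enumerate P?)
  enumerate! P? = Unique.filter⁺ P? (Unique.upTo⁺ (m + (m + d)))

  ∈-enumerate⁻ : ∀ {P : Pred ℕ Level.zero} (P? : Decidable P) {x} → x ∈ₗ enumerate P? → P x
  ∈-enumerate⁻ P? = proj₂ ∘ ∈-filter⁻ P? {xs = upTo (m + (m + d))}

  ∈-enumerate⁺ : ∀ {P : Pred ℕ Level.zero} (P? : Decidable P) {x} → x ∈ Apéry → P x → x ∈ₗ enumerate P?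
  ∈-enumerate⁺ P? x∈Ap = ∈-filter⁺ P? (∈-upTo⁺ (Apéry-< x∈Ap))

  P₂? : Decidable (Level₂ ∩ (_∉ Decomposable))
  P₂? = Level₂? ∩? Indecomposable?
  D₂? : Decidable (Level₂ ∩ Decomposable)
  D₂? = Level₂? ∩? Decomposable?
  P₃? : Decidable (Level₃ ∩ (_∉ Decomposable))
  P₃? = Level₃? ∩? Indecomposable?
  D₃? : Decidable (Level₃ ∩ Decomposable)
  D₃? = Level₃? ∩? Decomposable?

  X₁ P₂ D₂ P₃ D₃ : List ℕ
  X₁ = enumerate Level₁?
  P₂ = enumerate P₂?
  D₂ = enumerate D₂?
  P₃ = enumerate P₃?
  D₃ = enumerate D₃?

  X₁⁻ : ∀ {x} → x ∈ₗ X₁ → Level₁ x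
  X₁⁻ = ∈-enumerate⁻ Level₁?
  P₂⁻ : ∀ {x} → x ∈ₗ P₂ → Level₂ x × x ∉ Decomposable
  P₂⁻ = ∈-enumerate⁻ P₂?
  D₂⁻ : ∀ {x} → x ∈ₗ D₂ → Level₂ x × x ∈ Decomposable
  D₂⁻ = ∈-enumerate⁻ D₂?
  P₃⁻ : ∀ {x} → x ∈ₗ P₃ → Level₃ x × x ∉ Decomposable
  P₃⁻ = ∈-enumerate⁻ P₃?
  D₃⁻ : ∀ {x} → x ∈ₗ D₃ → Level₃ x × x ∈ Decomposable
  D₃⁻ = ∈-enumerate⁻ D₃?

  data Low (x : ℕ) : Set where
    inX₁ : x ∈ₗ X₁ → Low x
    inP₂ : x ∈ₗ P₂ → Low x
    inD₂ : x ∈ₗ D₂ → Low x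

  low : ∀ {x} → x ∈ Apéry → 0 < x → x < m + d → Low x
  low {x} x∈Ap 0<x x<c with x <? d
  ... | yes x<d = inX₁ (∈-enumerate⁺ Level₁? x∈Ap (x∈Ap , 0<x , x<d))
  ... | no x≮d with Decomposable? x
  ...   | yes x∈D = inD₂ (∈-enumerate⁺ D₂? x∈Ap ((x∈Ap , ≮⇒≥ x≮d , x<c) , x∈D))
  ...   | no x∉D  = inP₂ (∈-enumerate⁺ P₂? x∈Ap ((x∈Ap , ≮⇒≥ x≮d , x<c) , x∉D))

  X₁> : ∀ {x} → x ∈ₗ X₁ → m < x
  X₁> x∈ = let x∈Ap , 0<x , _ = X₁⁻ x∈ in Apéry-> x∈Ap 0<x

  X₁∈S : ∀ {x} → x ∈ₗ X₁ → x ∈ S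
  X₁∈S x∈ = proj₁ (proj₁ (X₁⁻ x∈))

  0<d : 0 < d
  0<d = <-trans 0<m m<d

  -- Both summands are Apéry elements, and each takes at least `m` out of a total below `d + m`,
  -- leaving less than `d` for the other.
  D₂⊆X₁⊕X₁ : D₂ ⊆ X₁ ⊕ X₁
  D₂⊆X₁⊕X₁ u∈ with D₂⁻ u∈
  ... | (u∈Ap , _ , u<c) , a , b , a∈S , b∈S , 0<a , 0<b , refl = ∈-⊕⁺
    (∈-enumerate⁺ Level₁? a∈Ap (a∈Ap , 0<a ,
      <-summand a (subst (a + b <_) (+-comm m d) u<c) (m-least b∈S 0<b)))
    (∈-enumerate⁺ Level₁? b∈Ap (b∈Ap , 0<b ,
      <-summand b (subst (_< d + m) (+-comm a b) (subst (a + b <_) (+-comm m d) u<c)) (m-least a∈S 0<a)))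
    where
    a∈Ap : a ∈ Apéry
    a∈Ap = Apéry-summandˡ a∈S b∈S u∈Ap
    b∈Ap : b ∈ Apéry
    b∈Ap = Apéry-summandʳ a∈S b∈S u∈Ap

  -- Covering `D₃` by four kinds of sums

  infix 4 _within_
  _within_ : List ℕ → List ℕ → List ℕ
  zs within ws = filter (_∈? ws) zs

  D₁₁ D₁ₚ D₁ₜ Dₚₚ : List ℕ
  D₁₁ = D₃ within X₁ ⊕ X₁
  D₁ₚ = D₃ within X₁ ⊕ P₂
  D₁ₜ = D₃ within X₁ ⊕ D₂
  Dₚₚ = D₃ within P₂ ⊕ P₂

  within! : ∀ ws → Unique (D₃ within ws)
  within! ws = Unique.filter⁺ (_∈? ws) (enumerate! D₃?)

  within⁻ : ∀ ws {z} → z ∈ₗ (D₃ within ws) → z ∈ₗ D₃ × z ∈ₗ ws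
  within⁻ ws = ∈-filter⁻ (_∈? ws)

  -- A decomposable element is at least `m + m`, so adding `d` or more already reaches the upper
  -- bound for Apéry elements.
  level₂+D₂∉Apéry : ∀ {a b} → d ≤ a → b ∈ₗ D₂ → a + b ∉ Apéry
  level₂+D₂∉Apéry {a} {b} d≤a b∈ a+b∈Ap = <⇒≱ (Apéry-< a+b∈Ap) (begin
    m + (m + d)  ≡⟨ +-assoc m m d ⟨
    m + m + d    ≡⟨ +-comm (m + m) d ⟩
    d + (m + m)  ≤⟨ +-mono-≤ d≤a (decomposable-≥2m (proj₂ (D₂⁻ b∈))) ⟩
    a + b        ∎)
    where open ≤-Reasoning

  -- Each summand leaves less than `m + d` for the other, so both are classified by `Low`. Of the
  -- six unordered kinds of pairs, `level₂+D₂∉Apéry` excludes `P₂` with `D₂` and `D₂` with `D₂`.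
  D₃-cover : D₃ ⊆ D₁₁ ++ (D₁ₚ ++ (D₁ₜ ++ Dₚₚ))
  D₃-cover {z} z∈ with D₃⁻ z∈
  ... | (z∈Ap , _) , a , b , a∈S , b∈S , 0<a , 0<b , refl =
    classify (low a∈Ap 0<a (summand-< b∈Ap 0<b (subst (_< m + (m + d)) (+-comm a b) (Apéry-< z∈Ap))))
             (low b∈Ap 0<b (summand-< a∈Ap 0<a (Apéry-< z∈Ap)))
    where
    a∈Ap : a ∈ Apéry
    a∈Ap = Apéry-summandˡ a∈S b∈S z∈Ap
    b∈Ap : b ∈ Apéry
    b∈Ap = Apéry-summandʳ a∈S b∈S z∈Ap
    summand-< : ∀ {x y} → x ∈ Apéry → 0 < x → x + y < m + (m + d) → y < m + d
    summand-< {x} {y} x∈Ap 0<x x+y< = <-summand y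
      (subst (_< m + d + m) (+-comm x y) (subst (x + y <_) (+-comm m (m + d)) x+y<))
      (m-least (proj₁ x∈Ap) 0<x)

    put₁₁ : a + b ∈ₗ X₁ ⊕ X₁ → a + b ∈ₗ D₁₁ ++ (D₁ₚ ++ (D₁ₜ ++ Dₚₚ))
    put₁₁ w = ∈-++⁺ˡ (∈-filter⁺ (_∈? X₁ ⊕ X₁) z∈ w)
    put₁ₚ : a + b ∈ₗ X₁ ⊕ P₂ → a + b ∈ₗ D₁₁ ++ (D₁ₚ ++ (D₁ₜ ++ Dₚₚ))
    put₁ₚ w = ∈-++⁺ʳ D₁₁ (∈-++⁺ˡ (∈-filter⁺ (_∈? X₁ ⊕ P₂) z∈ w))
    put₁ₜ : a + b ∈ₗ X₁ ⊕ D₂ → a + b ∈ₗ D₁₁ ++ (D₁ₚ ++ (D₁ₜ ++ Dₚₚ))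
    put₁ₜ w = ∈-++⁺ʳ D₁₁ (∈-++⁺ʳ D₁ₚ (∈-++⁺ˡ (∈-filter⁺ (_∈? X₁ ⊕ D₂) z∈ w)))
    putₚₚ : a + b ∈ₗ P₂ ⊕ P₂ → a + b ∈ₗ D₁₁ ++ (D₁ₚ ++ (D₁ₜ ++ Dₚₚ))
    putₚₚ w = ∈-++⁺ʳ D₁₁ (∈-++⁺ʳ D₁ₚ (∈-++⁺ʳ D₁ₜ (∈-filter⁺ (_∈? P₂ ⊕ P₂) z∈ w)))

    flip⊕ : ∀ {xs ys} → a ∈ₗ ys → b ∈ₗ xs → a + b ∈ₗ xs ⊕ ys
    flip⊕ {xs} {ys} a∈ b∈ = subst (_∈ₗ xs ⊕ ys) (+-comm b a) (∈-⊕⁺ b∈ a∈)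

    classify : Low a → Low b → a + b ∈ₗ D₁₁ ++ (D₁ₚ ++ (D₁ₜ ++ Dₚₚ))
    classify (inX₁ a∈) (inX₁ b∈) = put₁₁ (∈-⊕⁺ a∈ b∈)
    classify (inX₁ a∈) (inP₂ b∈) = put₁ₚ (∈-⊕⁺ a∈ b∈)
    classify (inX₁ a∈) (inD₂ b∈) = put₁ₜ (∈-⊕⁺ a∈ b∈)
    classify (inP₂ a∈) (inX₁ b∈) = put₁ₚ (flip⊕ a∈ b∈)
    classify (inP₂ a∈) (inP₂ b∈) = putₚₚ (∈-⊕⁺ a∈ b∈)
    classify (inD₂ a∈) (inX₁ b∈) = put₁ₜ (flip⊕ a∈ b∈)
    classify (inP₂ a∈) (inD₂ b∈) =
      contradiction z∈Ap (level₂+D₂∉Apéry (proj₁ (proj₂ (proj₁ (P₂⁻ a∈)))) b∈)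
    classify (inD₂ a∈) (inD₂ b∈) =
      contradiction z∈Ap (level₂+D₂∉Apéry (proj₁ (proj₂ (proj₁ (D₂⁻ a∈)))) b∈)
    classify (inD₂ a∈) (inP₂ b∈) =
      contradiction (subst Apéry (+-comm a b) z∈Ap)
        (level₂+D₂∉Apéry (proj₁ (proj₂ (proj₁ (P₂⁻ b∈)))) a∈)

  -- Sizes of the four pieces of `D₃`

  D₃-bound : length D₃ ≤ length D₁₁ + (length D₁ₚ + (length D₁ₜ + length Dₚₚ))
  D₃-bound = subst (length D₃ ≤_)
    (trans (length-++ D₁₁) (cong (length D₁₁ +_)
      (trans (length-++ D₁ₚ) (cong (length D₁ₚ +_) (length-++ D₁ₜ)))))
    (unique-⊆⇒length-≤ (enumerate! D₃?) D₃-cover)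

  -- The conductor separates `D₂` from `D₁₁`, so both fit without overlap into the one sumset
  -- `X₁ ⊕ X₁` and share a single bound.
  D₁₁-bound : (length D₂ + length D₁₁) * 2 ≤ length X₁ * suc (length X₁)
  D₁₁-bound = subst (λ l → l * 2 ≤ length X₁ * suc (length X₁)) (length-++ D₂)
    (⊕-square-count X₁ (D₂ ++ D₁₁)
      (Unique.++⁺ (enumerate! D₂?) (within! (X₁ ⊕ X₁)) disjoint) ⊆X₁⊕X₁)
    where
    disjoint : ∀ {x} → ¬ (x ∈ₗ D₂ × x ∈ₗ D₁₁)
    disjoint (x∈D₂ , x∈D₁₁) with D₂⁻ x∈D₂ | D₃⁻ (proj₁ (within⁻ (X₁ ⊕ X₁) x∈D₁₁))
    ... | (_ , _ , x<c) , _ | (_ , c≤x) , _ = <⇒≱ x<c c≤x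
    ⊆X₁⊕X₁ : D₂ ++ D₁₁ ⊆ X₁ ⊕ X₁
    ⊆X₁⊕X₁ x∈ with ∈-++⁻ D₂ x∈
    ... | inj₁ x∈D₂  = D₂⊆X₁⊕X₁ x∈D₂
    ... | inj₂ x∈D₁₁ = proj₂ (within⁻ (X₁ ⊕ X₁) x∈D₁₁)

  D₁ₚ-bound : length D₁ₚ ≤ length X₁ * length P₂
  D₁ₚ-bound = subst (length D₁ₚ ≤_) (length-cartesianProductWith _+_ X₁ P₂)
    (unique-⊆⇒length-≤ (within! (X₁ ⊕ P₂)) (proj₂ ∘ within⁻ (X₁ ⊕ P₂)))

  D₁ₜ-bound : length D₁ₜ * 3 ≤ length D₂ * (2 + length X₁)
  D₁ₜ-bound = ⊕-cube-count X₁ D₂ D₁ₜ (within! (X₁ ⊕ D₂)) D₂⊆X₁⊕X₁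
    (proj₂ ∘ within⁻ (X₁ ⊕ D₂)) closed
    where
    -- The partial sum is in the second level: two elements above `m` give more than `m + m`, hence
    -- at least `d`, and `w` takes at least `m` of a total below `m + (m + d)`.
    closed : ∀ {x y w} → x ∈ₗ X₁ → y ∈ₗ X₁ → w ∈ₗ X₁ → x + y + w ∈ₗ D₁ₜ → x + y ∈ₗ D₂
    closed {x} {y} {w} x∈ y∈ w∈ z∈ = ∈-enumerate⁺ D₂? xy∈Ap
      ((xy∈Ap , ≤-trans d≤2m (<⇒≤ (+-mono-< (X₁> x∈) (X₁> y∈))) ,
        <-summand (x + y) (subst (x + y + w <_) (+-comm m (m + d)) (Apéry-< z∈Ap)) (<⇒≤ (X₁> w∈))) ,
       x , y , X₁∈S x∈ , X₁∈S y∈ , <-trans 0<m (X₁> x∈) , <-trans 0<m (X₁> y∈) , refl)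
      where
      z∈Ap : x + y + w ∈ Apéry
      z∈Ap = proj₁ (proj₁ (D₃⁻ (proj₁ (within⁻ (X₁ ⊕ D₂) z∈))))
      xy∈Ap : x + y ∈ Apéry
      xy∈Ap = Apéry-summandˡ (+-closed (X₁∈S x∈) (X₁∈S y∈)) (X₁∈S w∈) z∈Ap

  Dₚₚ-bound : length Dₚₚ * 2 ≤ length P₂ * suc (length P₂)
  Dₚₚ-bound = ⊕-square-count P₂ Dₚₚ (within! (P₂ ⊕ P₂)) (proj₂ ∘ within⁻ (P₂ ⊕ P₂))

  -- Sums of two elements that are at least `d` lie in the interval from `d + d` up to
  -- `m + (m + d)`, which has length `ρ`.
  Dₚₚ-bound-ρ : length Dₚₚ ≤ ρ
  Dₚₚ-bound-ρ = subst (length Dₚₚ ≤_)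
    (trans (length-map (d + d +_) (upTo ρ)) (length-upTo ρ))
    (unique-⊆⇒length-≤ (within! (P₂ ⊕ P₂)) ⊆interval)
    where
    top≡ : m + (m + d) ≡ d + d + ρ
    top≡ = begin
      m + (m + d)  ≡⟨ +-assoc m m d ⟨
      m + m + d    ≡⟨ cong (_+ d) d+ρ≡2m ⟨
      d + ρ + d    ≡⟨ rearrange d ρ ⟩
      d + d + ρ    ∎
      where
      open ≡-Reasoning
      rearrange : ∀ d ρ → d + ρ + d ≡ d + d + ρ
      rearrange = solve-∀
    ⊆interval : Dₚₚ ⊆ map (d + d +_) (upTo ρ)
    ⊆interval {z} z∈ with within⁻ (P₂ ⊕ P₂) z∈
    ... | z∈D₃ , z∈⊕ with ∈-⊕⁻ P₂ P₂ z∈⊕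
    ...   | a , b , a∈ , b∈ , refl = subst (_∈ₗ map (d + d +_) (upTo ρ)) z≡
      (∈-map⁺ (d + d +_) (∈-upTo⁺ (+-cancelˡ-< (d + d) _ _
        (subst (_< d + d + ρ) (sym z≡) (subst (a + b <_) top≡ (Apéry-< (proj₁ (proj₁ (D₃⁻ z∈D₃)))))))))
      where
      z≡ : d + d + (a + b ∸ (d + d)) ≡ a + b
      z≡ = m+[n∸m]≡n (+-mono-≤ (proj₁ (proj₂ (proj₁ (P₂⁻ a∈)))) (proj₁ (proj₂ (proj₁ (P₂⁻ b∈)))))

  -- Bounding `m`, the left part and the generators by the list sizes

  X₁-disjoint : ∀ {x} → d ≤ x → x ∉ₗ X₁
  X₁-disjoint d≤x x∈ = <⇒≱ (proj₂ (proj₂ (X₁⁻ x∈))) d≤x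

  lowApéry : List ℕ
  lowApéry = 0 ∷ X₁ ++ (P₂ ++ D₂)

  lowApéry-length : length lowApéry ≡ suc (length X₁ + (length P₂ + length D₂))
  lowApéry-length = cong suc (trans (length-++ X₁) (cong (length X₁ +_) (length-++ P₂)))

  lowApéry⁻ : ∀ {x} → x ∈ₗ lowApéry → x ∈ Apéry × x < m + d
  lowApéry⁻ (here refl) = 0∈Apéry , <-≤-trans 0<m (m≤m+n m d)
  lowApéry⁻ (there x∈) with ∈-++⁻ X₁ x∈
  ... | inj₁ x∈X₁ = let x∈Ap , _ , x<d = X₁⁻ x∈X₁ in x∈Ap , <-≤-trans x<d (m≤n+m d m)
  ... | inj₂ x∈X₂ with ∈-++⁻ P₂ x∈X₂
  ...   | inj₁ x∈P₂ = let (x∈Ap , _ , x<c) , _ = P₂⁻ x∈P₂ in x∈Ap , x<c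
  ...   | inj₂ x∈D₂ = let (x∈Ap , _ , x<c) , _ = D₂⁻ x∈D₂ in x∈Ap , x<c

  lowApéry! : Unique lowApéry
  lowApéry! = All.tabulate (λ x∈ → 0≢ x∈) ∷
    Unique.++⁺ (enumerate! Level₁?)
      (Unique.++⁺ (enumerate! P₂?) (enumerate! D₂?) λ (x∈P₂ , x∈D₂) → proj₂ (P₂⁻ x∈P₂) (proj₂ (D₂⁻ x∈D₂)))
      (λ (x∈X₁ , x∈X₂) → X₁-disjoint (X₂≥ x∈X₂) x∈X₁)
    where
    X₂≥ : ∀ {x} → x ∈ₗ P₂ ++ D₂ → d ≤ x
    X₂≥ x∈ with ∈-++⁻ P₂ x∈
    ... | inj₁ x∈P₂ = proj₁ (proj₂ (proj₁ (P₂⁻ x∈P₂)))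
    ... | inj₂ x∈D₂ = proj₁ (proj₂ (proj₁ (D₂⁻ x∈D₂)))
    0≢ : ∀ {x} → x ∈ₗ X₁ ++ (P₂ ++ D₂) → 0 ≢ x
    0≢ x∈ refl with ∈-++⁻ X₁ x∈
    ... | inj₁ 0∈X₁ = <⇒≱ (X₁> 0∈X₁) z≤n
    ... | inj₂ 0∈X₂ = <⇒≱ 0<d (X₂≥ 0∈X₂)

  -- Subtracting `m` preserves the residue; the descent stops where the next subtraction would leave
  -- `S`, which is an Apéry element.
  Apéry-representative : ∀ .{{_ : NonZero m}} x → x ∈ S → ∃[ w ] w ∈ Apéry × w % m ≡ x % m
  Apéry-representative = <-rec (λ x → x ∈ S → ∃[ w ] w ∈ Apéry × w % m ≡ x % m) step
    where
    step : ∀ x → (∀ {y} → y < x → y ∈ S → ∃[ w ] w ∈ Apéry × w % m ≡ y % m) →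
      x ∈ S → ∃[ w ] w ∈ Apéry × w % m ≡ x % m
    step x rec x∈S with m ≤? x ×-dec S? (x ∸ m)
    ... | no ¬shift = x , (x∈S , ¬shift) , refl
    ... | yes (m≤x , x∸m∈S) with rec (∸-monoʳ-< 0<m m≤x) x∸m∈S
    ...   | w , w∈Ap , w≡ = w , w∈Ap , trans w≡
      (trans (sym ([m+n]%n≡m%n (x ∸ m) m)) (cong (_% m) (m∸n+n≡m m≤x)))

  -- Every one of the `m` residue classes contains an Apéry element, and the five lists together
  -- with 0 exhaust those.
  multiplicity-bound : .{{_ : NonZero m}} →
    m ≤ suc (length X₁ + (length P₂ + (length D₂ + (length P₃ + length D₃))))
  multiplicity-bound = begin
    m                     ≡⟨ length-upTo m ⟨
    length (upTo m)       ≡⟨ *-identityʳ _ ⟨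
    length (upTo m) * 1   ≤⟨ multiplicity-count (_% m) 1 apéry (upTo m) (Unique.upTo⁺ m) fibre ⟩
    length apéry          ≡⟨ cong suc (trans (length-++ X₁) (cong (length X₁ +_)
                               (trans (length-++ P₂) (cong (length P₂ +_)
                               (trans (length-++ D₂) (cong (length D₂ +_) (length-++ P₃))))))) ⟩
    suc (length X₁ + (length P₂ + (length D₂ + (length P₃ + length D₃)))) ∎
    where
    open ≤-Reasoning
    apéry : List ℕ
    apéry = 0 ∷ X₁ ++ (P₂ ++ (D₂ ++ (P₃ ++ D₃)))
    apéry⁺ : ∀ {x} → x ∈ Apéry → x ∈ₗ apéry
    apéry⁺ {x} x∈Ap with x ≟ 0
    ... | yes refl = here refl
    ... | no x≢0 with x <? m + d
    ...   | yes x<c with low x∈Ap (n≢0⇒n>0 x≢0) x<c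
    ...     | inX₁ x∈ = there (∈-++⁺ˡ x∈)
    ...     | inP₂ x∈ = there (∈-++⁺ʳ X₁ (∈-++⁺ˡ x∈))
    ...     | inD₂ x∈ = there (∈-++⁺ʳ X₁ (∈-++⁺ʳ P₂ (∈-++⁺ˡ x∈)))
    apéry⁺ {x} x∈Ap | no x≢0 | no x≮c with Decomposable? x
    ...     | yes x∈D = there (∈-++⁺ʳ X₁ (∈-++⁺ʳ P₂ (∈-++⁺ʳ D₂ (∈-++⁺ʳ P₃
                          (∈-enumerate⁺ D₃? x∈Ap ((x∈Ap , ≮⇒≥ x≮c) , x∈D))))))
    ...     | no x∉D  = there (∈-++⁺ʳ X₁ (∈-++⁺ʳ P₂ (∈-++⁺ʳ D₂ (∈-++⁺ˡ
                          (∈-enumerate⁺ P₃? x∈Ap ((x∈Ap , ≮⇒≥ x≮c) , x∉D))))))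
    fibre : ∀ {i} → i ∈ₗ upTo m →
      ∃[ ws ] Unique ws × length ws ≡ 1 × All (λ w → w ∈ₗ apéry × w % m ≡ i) ws
    -- This witness has residue `i` and, since `m` is positive, is past the conductor, so it lies in
    -- `S`.
    fibre {i} i∈ with Apéry-representative (i + (m + d) * m)
      (conductor (≤-trans (m≤m*n (m + d) m) (m≤n+m _ i)))
    ... | w , w∈Ap , w≡ = [ w ] , [] ∷ [] , refl ,
      (apéry⁺ w∈Ap , trans w≡ (trans ([m+kn]%n≡m%n i (m + d) m) (m<n⇒m%n≡m (∈-upTo⁻ i∈)))) ∷ []

  -- Besides the Apéry elements below the conductor, the left part contains the shifts by `m` of 0,
  -- `m` and `X₁`. These stay below `m + d` because the shifted elements are below `d`, and no shift
  -- is an Apéry element.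
  left-bound : (ys : List ℕ) → (∀ {x} → x ∈ S → x < m + d → x ∈ₗ ys) →
    suc (suc (length X₁)) + suc (length X₁ + (length P₂ + length D₂)) ≤ length ys
  left-bound ys ys-complete = subst (_≤ length ys)
    (trans (length-++ (map (m +_) (0 ∷ m ∷ X₁)))
      (cong₂ _+_ (cong (suc ∘ suc) (length-map (m +_) X₁)) lowApéry-length))
    (unique-⊆⇒length-≤
      (Unique.++⁺ (Unique.map⁺ (+-cancelˡ-≡ m _ _) base!) lowApéry! disjoint) ⊆ys)
    where
    base! : Unique (0 ∷ m ∷ X₁)
    base! = (<⇒≢ 0<m ∷ All.tabulate (λ x∈ → <⇒≢ (<-trans 0<m (X₁> x∈)))) ∷
      All.tabulate (λ x∈ → <⇒≢ (X₁> x∈)) ∷ enumerate! Level₁?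
    base⁻ : ∀ {x} → x ∈ₗ 0 ∷ m ∷ X₁ → x ∈ S × x < d
    base⁻ (here refl)         = 0∈S , 0<d
    base⁻ (there (here refl)) = m∈S , m<d
    base⁻ (there (there x∈))  = X₁∈S x∈ , proj₂ (proj₂ (X₁⁻ x∈))
    disjoint : ∀ {x} → ¬ (x ∈ₗ map (m +_) (0 ∷ m ∷ X₁) × x ∈ₗ lowApéry)
    disjoint (x∈shift , x∈low) with ∈-map⁻ (m +_) x∈shift
    ... | y , y∈ , refl = m+S∉Apéry (proj₁ (base⁻ y∈)) (proj₁ (lowApéry⁻ x∈low))
    ⊆ys : map (m +_) (0 ∷ m ∷ X₁) ++ lowApéry ⊆ ys
    ⊆ys x∈ with ∈-++⁻ (map (m +_) (0 ∷ m ∷ X₁)) x∈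
    ... | inj₂ x∈low = let x∈Ap , x<c = lowApéry⁻ x∈low in ys-complete (proj₁ x∈Ap) x<c
    ... | inj₁ x∈shift with ∈-map⁻ (m +_) x∈shift
    ...   | y , y∈ , refl = ys-complete (+-closed m∈S (proj₁ (base⁻ y∈)))
                              (+-monoʳ-< m (proj₂ (base⁻ y∈)))

  -- Decomposable elements are at least `m + m`, hence at least `d`, so `m` and all of `X₁` are
  -- primitive, like `P₂` and `P₃`.
  generators-bound : (gs : List ℕ) →
    (∀ {x} → x ∈ S → 0 < x → x ∉ Decomposable → x ∈ₗ gs) →
    suc (length X₁ + (length P₂ + length P₃)) ≤ length gs
  generators-bound gs gs-complete = subst (_≤ length gs)
    (cong suc (trans (length-++ X₁) (cong (length X₁ +_) (length-++ P₂))))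
    (unique-⊆⇒length-≤ primitives! ⊆gs)
    where
    P₃≥ : ∀ {x} → x ∈ₗ P₃ → m + d ≤ x
    P₃≥ x∈ = proj₂ (proj₁ (P₃⁻ x∈))
    P₂P₃⁻ : ∀ {x} → x ∈ₗ P₂ ++ P₃ → x ∈ S × d ≤ x × x ∉ Decomposable
    P₂P₃⁻ x∈ with ∈-++⁻ P₂ x∈
    ... | inj₁ x∈P₂ = let (x∈Ap , d≤x , _) , x∉D = P₂⁻ x∈P₂ in proj₁ x∈Ap , d≤x , x∉D
    ... | inj₂ x∈P₃ = let (x∈Ap , c≤x) , x∉D = P₃⁻ x∈P₃ in
                        proj₁ x∈Ap , ≤-trans (m≤n+m d m) c≤x , x∉D
    m≢ : ∀ {x} → x ∈ₗ X₁ ++ (P₂ ++ P₃) → m ≢ x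
    m≢ x∈ with ∈-++⁻ X₁ x∈
    ... | inj₁ x∈X₁ = <⇒≢ (X₁> x∈X₁)
    ... | inj₂ x∈P  = <⇒≢ (<-≤-trans m<d (proj₁ (proj₂ (P₂P₃⁻ x∈P))))
    primitives! : Unique (m ∷ X₁ ++ (P₂ ++ P₃))
    primitives! = All.tabulate m≢ ∷
      Unique.++⁺ (enumerate! Level₁?)
        (Unique.++⁺ (enumerate! P₂?) (enumerate! P₃?)
          λ (x∈P₂ , x∈P₃) → <⇒≱ (proj₂ (proj₂ (proj₁ (P₂⁻ x∈P₂)))) (P₃≥ x∈P₃))
        (λ (x∈X₁ , x∈P) → X₁-disjoint (proj₁ (proj₂ (P₂P₃⁻ x∈P))) x∈X₁)
    ⊆gs : m ∷ X₁ ++ (P₂ ++ P₃) ⊆ gs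
    ⊆gs (here refl) = gs-complete m∈S 0<m (λ m∈D → <⇒≱ (m<m+n m 0<m) (decomposable-≥2m m∈D))
    ⊆gs (there x∈) with ∈-++⁻ X₁ x∈
    ... | inj₁ x∈X₁ = gs-complete (X₁∈S x∈X₁) (<-trans 0<m (X₁> x∈X₁))
      (λ x∈D → X₁-disjoint (≤-trans d≤2m (decomposable-≥2m x∈D)) x∈X₁)
    ... | inj₂ x∈P = let x∈S , d≤x , x∉D = P₂P₃⁻ x∈P in gs-complete x∈S (<-≤-trans 0<d d≤x) x∉D

  -- Adding `ρ` turns the conductor into `m * 3`, and the same `ρ` pays for one copy of the sums of
  -- two elements of `P₂`.
  wilf : (gs ys : List ℕ) →
    (∀ {x} → x ∈ S → 0 < x → x ∉ Decomposable → x ∈ₗ gs) →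
    (∀ {x} → x ∈ S → x < m + d → x ∈ₗ ys) →
    m + d ≤ length gs * length ys
  wilf gs ys gs-complete ys-complete = +-cancelʳ-≤ ρ (m + d) _ (begin
    m + d + ρ
      ≡⟨ +-assoc m d ρ ⟩
    m + (d + ρ)
      ≡⟨ cong (m +_) d+ρ≡2m ⟩
    m + (m + m)
      ≡⟨ triple m ⟩
    m * 3
      ≤⟨ *-monoˡ-≤ 3 (multiplicity-bound {{>-nonZero 0<m}}) ⟩
    suc (length X₁ + (length P₂ + (length D₂ + (length P₃ + length D₃)))) * 3
      ≤⟨ wilf-arithmetic (length X₁) (length P₂) (length D₂) (length P₃) (length D₃)
           (length D₁₁) (length D₁ₚ) (length D₁ₜ) (length Dₚₚ) ρ
           D₁₁-bound D₁ₚ-bound D₁ₜ-bound Dₚₚ-bound Dₚₚ-bound-ρ D₃-bound ⟩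
    suc (length X₁ + (length P₂ + length P₃)) *
      (suc (suc (length X₁)) + suc (length X₁ + (length P₂ + length D₂))) + ρ
      ≤⟨ +-monoˡ-≤ ρ (*-mono-≤ (generators-bound gs gs-complete) (left-bound ys ys-complete)) ⟩
    length gs * length ys + ρ ∎)
    where
    open ≤-Reasoning
    triple : ∀ m → m + (m + m) ≡ m * 3
    triple = solve-∀

-- Translating the hypotheses of the theorem

-- The ceiling of `c / m` is minus the floor of `- c / m`, so that floor is -3, and `ρ` is the
-- remainder of `- c` modulo `m`.
ceiling-≡3 : ∀ c m .{{_ : NonZero m}} → ceiling ((ℤ.+ c) / m) ≡ ℤ.+ 3 →
  ∃[ ρ ] c + ρ ≡ m * 3 × ρ < m
ceiling-≡3 c m@(suc _) ceil≡3 = ρ , ℤ.+-injective c+ρ≡3m , ℤ.n%ℕd<d (ℤ.- ℤ.+ c) m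
  where
  ρ : ℕ
  ρ = (ℤ.- ℤ.+ c) ℤ.%ℕ m
  floor≡-3 : (ℤ.- ℤ.+ c) ℤ./ℕ m ≡ ℤ.-[1+ 2 ]
  floor≡-3 = ℤ.neg-injective
    (trans (cong ℤ.-_ (sym (ℤ.div-pos-is-/ℕ (ℤ.- ℤ.+ c) m))) ceil≡3)
  -c≡ : ℤ.- ℤ.+ c ≡ ℤ.+ ρ ℤ.+ ℤ.-[1+ 2 ] ℤ.* ℤ.+ m
  -c≡ = trans (ℤ.a≡a%ℕn+[a/ℕn]*n (ℤ.- ℤ.+ c) m) (cong (λ f → ℤ.+ ρ ℤ.+ f ℤ.* ℤ.+ m) floor≡-3)
  cancel : ∀ x y z → x ≡ y ℤ.+ ℤ.-[1+ 2 ] ℤ.* z → ℤ.- x ℤ.+ y ≡ z ℤ.* ℤ.+ 3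
  cancel _ y z refl = identity y z
    where
    identity : ∀ y z → ℤ.- (y ℤ.+ ℤ.-[1+ 2 ] ℤ.* z) ℤ.+ y ≡ z ℤ.* ℤ.+ 3
    identity = ℤ-Solver.solve-∀
  c+ρ≡3m : ℤ.+ (c + ρ) ≡ ℤ.+ (m * 3)
  c+ρ≡3m = trans (cong (ℤ._+ ℤ.+ ρ) (sym (ℤ.neg-involutive (ℤ.+ c))))
    (trans (cancel (ℤ.- ℤ.+ c) (ℤ.+ ρ) (ℤ.+ m) -c≡) (sym (ℤ.pos-* m 3)))

-- Induction on the derivation: a zero summand is discarded in favour of the other one, and two
-- positive summands form a decomposition.
nonzero-element : ∀ {gs x} → x ∈ ⟨ gs ⟩ → 0 < x → x ∈ₗ gs ⊎ SumOfNonzero ⟨ gs ⟩ x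
nonzero-element (gen x∈) _ = inj₁ x∈
nonzero-element (plus {zero}  {b} a∈ b∈) 0<x = nonzero-element b∈ 0<x
nonzero-element (plus {suc a} {zero} a∈ b∈) 0<x
  rewrite +-identityʳ a = nonzero-element a∈ 0<x
nonzero-element (plus {suc a} {suc b} a∈ b∈) _ =
  inj₂ (suc a , suc b , a∈ , b∈ , s≤s z≤n , s≤s z≤n , refl)

-- Wilf's inequality, by passing to a decidable semigroup

open import Data.Integer using (+_)

corollary6p5 : ∀ {ℓ : Level} (S : Pred ℕ ℓ) → IsNumericalSemigroup S →
    ∀ (m c e k : ℕ) .{{_ : NonZero m}} →
    IsMultiplicity S m →
    IsConductor S c →
    IsEmbeddingDimension S e →
    HasCardinality (L S c) k →
    ceiling ((+ c) / m) ≡ + 3 →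
    e * k ≥ c
corollary6p5 S S-semigroup m c e k ((m∈S , m≢0) , m-least) isConductor
  ((gs , _ , refl , ⟨gs⟩⊆S , S⊆⟨gs⟩) , _) (ys , _ , ys⇔ , refl) ceil≡3
  with ceiling-≡3 c m ceil≡3
... | ρ , c+ρ≡3m , ρ<m =
  subst (_≤ length gs * length ys) m+d≡c
    (DepthThree.wilf S′ S′? (S⊆S′ 0∈S) S′-closed m d ρ 0<m (S⊆S′ m∈S) S′-m-least m<d d+ρ≡2m
      (λ m+d≤x → conductor (subst (_≤ _) m+d≡c m+d≤x)) gs ys gs-complete ys-complete)
  where
  open IsNumericalSemigroup S-semigroup
  open Equivalence

  gaps : List ℕ
  gaps = proj₁ (proj₂ finite-complement)
  gaps⇔ : ∀ n → _
  gaps⇔ = proj₁ (proj₂ (proj₂ (proj₂ finite-complement)))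

  -- The double complement of S: decidable, although S itself need not be.
  S′ : Pred ℕ Level.zero
  S′ = _∉ₗ gaps
  S′? : Decidable S′
  S′? x = ¬? (x ∈? gaps)
  S⊆S′ : ∀ {x} → x ∈ S → x ∈ S′
  S⊆S′ {x} x∈S x∈gaps = from (gaps⇔ x) x∈gaps x∈S
  -- This allows `x ∈ S` to be assumed whenever the goal is decidable or a negation, as with
  -- inequalities and list membership.
  S′⊆¬¬S : ∀ {x} → x ∈ S′ → ¬ ¬ (x ∈ S)
  S′⊆¬¬S {x} x∈S′ x∉S = x∈S′ (to (gaps⇔ x) x∉S)
  S′-closed : ∀ {a b} → a ∈ S′ → b ∈ S′ → a + b ∈ S′
  S′-closed a∈S′ b∈S′ a+b∈gaps =
    S′⊆¬¬S a∈S′ λ a∈S → S′⊆¬¬S b∈S′ λ b∈S → S⊆S′ (+-closed a∈S b∈S) a+b∈gaps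

  0<m : 0 < m
  0<m = n≢0⇒n>0 m≢0
  S′-m-least : ∀ {x} → x ∈ S′ → 0 < x → m ≤ x
  S′-m-least {x} x∈S′ 0<x = decidable-stable (m ≤? x) λ m≰x →
    S′⊆¬¬S x∈S′ λ x∈S → m≰x (m-least x (x∈S , >⇒≢ 0<x))

  gap< : ∀ {x} → IsConductor S c → x ∈ ∁ S → x < c
  gap< (inj₁ (noGaps , _))             x∉S = contradiction x∉S (noGaps _)
  gap< (inj₂ (f , (_ , f-max) , refl)) x∉S = s≤s (f-max _ x∉S)
  conductor : ∀ {x} → c ≤ x → x ∈ S′
  conductor {x} c≤x x∈gaps = <⇒≱ (gap< isConductor (from (gaps⇔ x) x∈gaps)) c≤x

  d : ℕ
  d = c ∸ m
  2m<c : m + m < c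
  2m<c = +-cancelʳ-< ρ (m + m) c (begin-strict
    m + m + ρ     <⟨ +-monoʳ-< (m + m) ρ<m ⟩
    m + m + m     ≡⟨ triple m ⟩
    m * 3         ≡⟨ c+ρ≡3m ⟨
    c + ρ         ∎)
    where
    open ≤-Reasoning
    triple : ∀ m → m + m + m ≡ m * 3
    triple = solve-∀
  m+d≡c : m + d ≡ c
  m+d≡c = m+[n∸m]≡n (≤-trans (m≤m+n m m) (<⇒≤ 2m<c))
  m<d : m < d
  m<d = +-cancelˡ-< m m d (subst (m + m <_) (sym m+d≡c) 2m<c)
  d+ρ≡2m : d + ρ ≡ m + m
  d+ρ≡2m = +-cancelˡ-≡ m _ _ (begin
    m + (d + ρ)  ≡⟨ +-assoc m d ρ ⟨
    m + d + ρ    ≡⟨ cong (_+ ρ) m+d≡c ⟩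
    c + ρ        ≡⟨ c+ρ≡3m ⟩
    m * 3        ≡⟨ triple m ⟩
    m + (m + m)  ∎)
    where
    open ≡-Reasoning
    triple : ∀ m → m * 3 ≡ m + (m + m)
    triple = solve-∀

  -- A decomposition inside `⟨ gs ⟩` is also one inside `S′`, so an indecomposable element of `S′`
  -- can only come from `gs` itself.
  gs-complete : ∀ {x} → x ∈ S′ → 0 < x → x ∉ SumOfNonzero S′ → x ∈ₗ gs
  gs-complete {x} x∈S′ 0<x x∉sum = decidable-stable (x ∈? gs) λ x∉gs →
    S′⊆¬¬S x∈S′ λ x∈S → case-⊎ x∉gs (nonzero-element (S⊆⟨gs⟩ x∈S) 0<x)
    where
    case-⊎ : x ∉ₗ gs → ¬ (x ∈ₗ gs ⊎ SumOfNonzero ⟨ gs ⟩ x)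
    case-⊎ x∉gs (inj₁ x∈gs) = x∉gs x∈gs
    case-⊎ _    (inj₂ (a , b , a∈ , b∈ , 0<a , 0<b , x≡)) =
      x∉sum (a , b , S⊆S′ (⟨gs⟩⊆S a∈) , S⊆S′ (⟨gs⟩⊆S b∈) , 0<a , 0<b , x≡)

  ys-complete : ∀ {x} → x ∈ S′ → x < m + d → x ∈ₗ ys
  ys-complete {x} x∈S′ x<m+d = decidable-stable (x ∈? ys) λ x∉ys →
    S′⊆¬¬S x∈S′ λ x∈S → x∉ys (to (ys⇔ x) (x∈S , subst (x <_) m+d≡c x<m+d))
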